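{- For every $\epsilon>0$ there exists an instance $(\mathcal{G},k)$ of IM-IoA for which there is a saturated assignment $\mathcal{P}$ such that $$\mathrm{IoA}(\mathcal{P})\ \le\ \left(\tfrac12+\epsilon\right)\cdot \mathrm{OPT}.$$
   Context: An instance of the problem IM-IoA consists of a finite undirected graph $\mathcal{G}=(\mathcal{V},\mathcal{E})$ with $n=|\mathcal{V}|$ and an integer $k\le n/2$. An assignment is a function $\mathcal{P}:\mathcal{V}\to\{1,2\}$ such that exactly $k$ vertices have type 1 and exactly $n-k$ vertices have type 2. A vertex is integrated under $\mathcal{P}$ if it has at least one neighbor whose type differs from its own. $\mathrm{IoA}(\mathcal{P})$ is the number of integrated vertices under $\mathcal{P}$, and $\mathrm{OPT}$ is the maximum of $\mathrm{IoA}$ over all assignments of the instance. An assignment $\mathcal{P}$ is saturated if no exchange of types between one type-1 vertex and one type-2 vertex yields an assignment with strictly larger $\mathrm{IoA}$. -}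

module Defs where

open import Data.Fin using (Fin)
open import Data.Fin.Permutation.Components using (transpose)
open import Data.Fin.Properties using (any?)
open import Data.List using (List; []; _∷_; length; filter; allFin; map; cartesianProductWith)
open import Data.List.Extrema.Nat using (max; xs≤max; argmax-sel)
open import Data.List.Membership.Propositional using (_∈_)
open import Data.List.Membership.Propositional.Properties
  using (∈-map⁺; ∈-map⁻; ∈-filter⁺; ∈-filter⁻; ∈-cartesianProductWith⁺)
open import Data.List.Properties using (filter-≐)
open import Data.List.Relation.Unary.All as All using ()
open import Data.List.Relation.Unary.Any using (here; there)
open import Data.Nat using (ℕ; zero; suc; _*_; _∸_; _≤_; _<_; z≤n)
open import Data.Nat.Properties as ℕ using (≤-antisym)
open import Data.Product using (∃; ∃-syntax; _×_; _,_; proj₁; proj₂)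
open import Data.Sum using (inj₁; inj₂)
open import Data.Vec using (Vec; []; _∷_; lookup; tabulate)
open import Data.Vec.Properties using (lookup∘tabulate)
open import Function using (id; _∘_)
open import Level using (0ℓ)
open import Relation.Binary using (Rel; Symmetric; Irreflexive; DecidableEquality)
import Relation.Binary as B
open import Relation.Binary.PropositionalEquality
  using (_≡_; _≢_; _≗_; refl; sym; trans; cong; subst)
open import Relation.Nullary using (¬_; yes; no; _×-dec_; ¬?)
open import Relation.Unary using (Pred; Decidable)

count : ∀ {n} {P : Pred (Fin n) 0ℓ} → Decidable P → ℕ
count {n} P? = length (filter P? (allFin n))

record Graph (n : ℕ) : Set₁ where
  infix 4 _~_ _~?_
  field
    _~_      : Rel (Fin n) 0ℓ
    _~?_     : B.Decidable _~_
    ~-sym    : Symmetric _~_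
    ~-irrefl : Irreflexive _≡_ _~_

record Instance : Set₁ where
  field
    {n}   : ℕ
    graph : Graph n
    k     : ℕ
    k≤n/2 : 2 * k ≤ n
  open Graph graph public

data Type : Set where
  type1 type2 : Type

infix 4 _≟_
_≟_ : DecidableEquality Type
type1 ≟ type1 = yes refl
type1 ≟ type2 = no λ ()
type2 ≟ type1 = no λ ()
type2 ≟ type2 = yes refl

#_of-type_ : ∀ {n} → (Fin n → Type) → Type → ℕ
# P of-type t = count (λ v → P v ≟ t)

allTypings : ∀ n → List (Vec Type n)
allTypings zero    = [] ∷ []
allTypings (suc n) = cartesianProductWith _∷_ (type1 ∷ type2 ∷ []) (allTypings n)

module _ (I : Instance) where
  open Instance I

  IsAssignment : (Fin n → Type) → Set
  IsAssignment P = # P of-type type1 ≡ k × # P of-type type2 ≡ n ∸ k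

  isAssignment? : Decidable IsAssignment
  isAssignment? P = (# P of-type type1 ℕ.≟ k) ×-dec (# P of-type type2 ℕ.≟ n ∸ k)

  Integrated : (Fin n → Type) → Fin n → Set
  Integrated P v = ∃[ w ] v ~ w × P w ≢ P v

  integrated? : ∀ P → Decidable (Integrated P)
  integrated? P v = any? λ w → (v ~? w) ×-dec ¬? (P w ≟ P v)

  IoA : (Fin n → Type) → ℕ
  IoA P = count (integrated? P)

  -- P ∘ transpose u v is P with the types of u and v exchanged.
  Saturated : (Fin n → Type) → Set
  Saturated P = ∀ u v → P u ≡ type1 → P v ≡ type2 →
    ¬ (IoA P < IoA (P ∘ transpose u v))

  assignments : List (Vec Type n)
  assignments = filter (isAssignment? ∘ lookup) (allTypings n)

  -- The default value 0 is immaterial: IoA is nonnegative, and the list is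
  -- nonempty because k ≤ n.  See OPT-upper and OPT-attained.
  OPT : ℕ
  OPT = max 0 (map (IoA ∘ lookup) assignments)

------------------------------------------------------------------------
-- OPT is the maximum of IoA over all assignments

∈-allTypings : ∀ {n} (xs : Vec Type n) → xs ∈ allTypings n
∈-allTypings []       = here refl
∈-allTypings (t ∷ xs) = ∈-cartesianProductWith⁺ _∷_ (∈-types t) (∈-allTypings xs)
  where
  ∈-types : ∀ t → t ∈ type1 ∷ type2 ∷ []
  ∈-types type1 = here refl
  ∈-types type2 = there (here refl)

#-cong : ∀ {n} {P Q : Fin n → Type} → P ≗ Q → ∀ t → # P of-type t ≡ # Q of-type t
#-cong {n} P≗Q t = cong length (filter-≐ _ _
  ((λ {v} → trans (sym (P≗Q v))) , (λ {v} → trans (P≗Q v))) (allFin n))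

module _ (I : Instance) where
  open Instance I

  IsAssignment-cong : ∀ {P Q} → P ≗ Q → IsAssignment I P → IsAssignment I Q
  IsAssignment-cong P≗Q (p₁ , p₂) =
    trans (sym (#-cong P≗Q type1)) p₁ , trans (sym (#-cong P≗Q type2)) p₂

  Integrated-cong : ∀ {P Q} → P ≗ Q → ∀ {v} → Integrated I P v → Integrated I Q v
  Integrated-cong P≗Q {v} (w , v~w , Pw≢Pv) =
    w , v~w , λ eq → Pw≢Pv (trans (P≗Q w) (trans eq (sym (P≗Q v))))

  IoA-cong : ∀ {P Q} → P ≗ Q → IoA I P ≡ IoA I Q
  IoA-cong P≗Q = cong length (filter-≐ _ _
    (Integrated-cong P≗Q , Integrated-cong (sym ∘ P≗Q)) (allFin n))

  OPT-upper : ∀ P → IsAssignment I P → IoA I P ≤ OPT I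
  OPT-upper P isA = subst (_≤ OPT I) (IoA-cong (lookup∘tabulate P))
    (All.lookup (xs≤max 0 (map (IoA I ∘ lookup) (assignments I)))
      (∈-map⁺ (IoA I ∘ lookup)
        (∈-filter⁺ (isAssignment? I ∘ lookup) (∈-allTypings (tabulate P))
          (IsAssignment-cong (sym ∘ lookup∘tabulate P) isA))))

  OPT-attained : ∃ (IsAssignment I) → ∃[ Q ] IsAssignment I Q × IoA I Q ≡ OPT I
  OPT-attained (P , isA)
    with argmax-sel id 0 (map (IoA I ∘ lookup) (assignments I))
  ... | inj₁ OPT≡0 = P , isA , ≤-antisym (OPT-upper P isA) (subst (_≤ IoA I P) (sym OPT≡0) z≤n)
  ... | inj₂ OPT∈
    with xs , xs∈ , eq ← ∈-map⁻ (IoA I ∘ lookup) OPT∈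
    = lookup xs
    , proj₂ (∈-filter⁻ (isAssignment? I ∘ lookup) {xs = allTypings n} xs∈)
    , sym eq

{-# OPTIONS --safe #-}
-- Let K = m + 1.  Take K stars with centres s i and leaves e i j (j < K), and
-- K further centres b j 0, where b j 0 is joined to every e i j and to m − 1
-- private leaves b j l (0 < l < m); use K vertices of type 1.
-- Giving type 1 to the s i integrates exactly the s i and the e i j, that is
-- K (K + 1) vertices, whereas giving type 1 to the b j 0 integrates all the
-- e i j and b j l, that is K (K + m).  The ratio tends to ½ as m grows.
-- The first assignment is saturated: once s i loses type 1, a vertex e i c
-- stays integrated only if c is the column of the vertex that receives type 1,
-- while the newly integrated b j l all lie in that column j, so
-- b j l ↦ e i (punchIn j l) sends the gained vertices injectively to lost ones.
module Submission where

open import Defs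
open import Data.Empty using (⊥)
open import Data.Fin using (Fin; zero; suc; punchIn)
import Data.Fin.Properties as Fin
open import Data.Fin.Permutation.Components using (transpose)
open import Data.Integer using (+_; +[1+_]; -[1+_])
import Data.Integer as ℤ
import Data.Integer.Properties as ℤ
open import Data.List using (List; []; _∷_; length; filter; allFin; lookup)
open import Data.List.Membership.Propositional using (_∈_)
open import Data.List.Membership.Propositional.Properties
  using (∈-lookup; ∈-filter⁺; ∈-filter⁻; ∈-allFin)
open import Data.List.Properties using (length-tabulate)
import Data.List.Relation.Unary.All as All
open import Data.List.Relation.Unary.AllPairs using (_∷_)
open import Data.List.Relation.Unary.Any using (index)
open import Data.List.Relation.Unary.Any.Properties using (lookup-index)
open import Data.List.Relation.Unary.Unique.Propositional using (Unique)
open import Data.List.Relation.Unary.Unique.Propositional.Properties using (allFin⁺; filter⁺)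
open import Data.Nat as ℕ using (ℕ)
open import Data.Nat.Coprimality using (Coprime)
import Data.Nat.Properties as ℕ
open import Data.Nat.Tactic.RingSolver using (solve-∀)
open import Data.Product using (Σ-syntax; _×_; _,_; proj₁; proj₂; ∃-syntax)
open import Data.Rational using (ℚ; 0ℚ; ½; _+_; _*_; _/_; _≤_; _<_; mkℚ; *<*; toℚᵘ)
import Data.Rational.Properties as ℚ
open import Data.Rational.Unnormalised as ℚᵘ using (mkℚᵘ; *≤*)
import Data.Rational.Unnormalised.Properties as ℚᵘ
open import Data.Sum using (_⊎_; inj₁; inj₂; swap)
open import Data.Sum.Function.Propositional using (_⊎-↔_)
open import Data.Sum.Properties using (inj₂-injective)
open import Data.Unit using (⊤; tt)
open import Function using (_∘_; _↔_; mk↔ₛ′; Inverse; Injection)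
open import Function.Definitions using (Injective)
open import Function.Properties.Inverse using (↔-refl; ↔-sym; ↔-trans; ↔⇒↣)
open import Level using (0ℓ)
open import Relation.Binary.PropositionalEquality
  using (_≡_; _≢_; refl; sym; trans; cong; cong₂; subst₂)
open import Relation.Nullary using (¬_; Dec; yes; no; contradiction; _⊎-dec_)
open import Relation.Unary using (Pred; Decidable)

-- Counting by injections.

lookup-injective : ∀ {A : Set} {xs : List A} → Unique xs → Injective _≡_ _≡_ (lookup xs)
lookup-injective (_ ∷ _)  {zero}  {zero}  _  = refl
lookup-injective (x∉ ∷ _) {zero}  {suc j} eq = contradiction eq (All.lookup x∉ (∈-lookup j))
lookup-injective (x∉ ∷ _) {suc i} {zero}  eq = contradiction (sym eq) (All.lookup x∉ (∈-lookup i))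
lookup-injective (_ ∷ u)  {suc i} {suc j} eq = cong suc (lookup-injective u eq)

module _ {n} {P : Pred (Fin n) 0ℓ} (P? : Decidable P) where

  private
    members : List (Fin n)
    members = filter P? (allFin n)

    ∈-members : ∀ {v} → P v → v ∈ members
    ∈-members {v} = ∈-filter⁺ P? (∈-allFin v)

    lookup-holds : ∀ i → P (lookup members i)
    lookup-holds i = proj₂ (∈-filter⁻ P? {xs = allFin n} (∈-lookup i))

  -- Positions in the duplicate-free filtered list inject into `Fin m`. Since `f` receives the proof
  -- of `P v`, it can be defined on the members alone.
  count-≤ : ∀ {m} (f : ∀ v → P v → Fin m) →
            (∀ {v w} p q → f v p ≡ f w q → v ≡ w) → count P? ℕ.≤ m
  count-≤ f f-inj = Fin.injective⇒≤ {f = λ i → f _ (lookup-holds i)}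
    (lookup-injective (filter⁺ P? (allFin⁺ n)) ∘ f-inj _ _)

  ≤-count : ∀ {m} (g : Fin m → Fin n) → Injective _≡_ _≡_ g → (∀ i → P (g i)) → m ℕ.≤ count P?
  ≤-count g g-inj Pg = Fin.injective⇒≤ {f = λ i → index (∈-members (Pg i))}
    λ {i} {j} eq → g-inj (trans (lookup-index (∈-members (Pg i)))
      (trans (cong (lookup members) eq) (sym (lookup-index (∈-members (Pg j))))))

  count-≡ : ∀ {m} (g : Fin m → Fin n) → Injective _≡_ _≡_ g → (∀ i → P (g i)) →
            (∀ v → P v → ∃[ i ] g i ≡ v) → count P? ≡ m
  count-≡ g g-inj Pg g⁻¹ = ℕ.≤-antisym
    (count-≤ (λ v p → proj₁ (g⁻¹ v p))
      (λ p q eq → trans (sym (proj₂ (g⁻¹ _ p))) (trans (cong g eq) (proj₂ (g⁻¹ _ q)))))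
    (≤-count g g-inj Pg)

-- `P` and `Q` may be incomparable: an injection of one into the other suffices. For saturation, `f`
-- will move gained vertices onto lost ones.
count-mono : ∀ {n} {P Q : Pred (Fin n) 0ℓ} (P? : Decidable P) (Q? : Decidable Q)
             (f : Fin n → Fin n) → (∀ {v} → P v → Q (f v)) →
             (∀ {v w} → P v → P w → f v ≡ f w → v ≡ w) → count P? ℕ.≤ count Q?
count-mono {n} P? Q? f PQ f-inj = count-≤ P? (λ v p → index (∈Q p))
  λ p q eq → f-inj p q (trans (lookup-index (∈Q p))
    (trans (cong (lookup (filter Q? (allFin n))) eq) (sym (lookup-index (∈Q q)))))
  where
  ∈Q : ∀ {v} → _ → f v ∈ filter Q? (allFin n)
  ∈Q p = ∈-filter⁺ Q? (∈-allFin _) (PQ p)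

-- Typings and the exchange of two types.

type1+type2 : ∀ {n} (P : Fin n → Type) → # P of-type type1 ℕ.+ # P of-type type2 ≡ n
type1+type2 {n} P = trans (go (allFin n)) (length-tabulate _)
  where
  go : ∀ xs → length (filter (λ v → P v ≟ type1) xs) ℕ.+
              length (filter (λ v → P v ≟ type2) xs) ≡ length xs
  go []       = refl
  go (x ∷ xs) with P x
  ... | type1 = cong ℕ.suc (go xs)
  ... | type2 = trans (ℕ.+-suc _ _) (cong ℕ.suc (go xs))

-- At `u` the exchanged typing takes the value `P v`, which is `type2`; away from `u` and `v`
-- nothing changes.
transpose-type1 : ∀ {n} (P : Fin n → Type) u v → P v ≡ type2 → ∀ w →
                  P (transpose u v w) ≡ type1 → w ≡ v ⊎ w ≢ u × P w ≡ type1
transpose-type1 P u v Pv w with w Fin.≟ u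
... | yes _ = λ eq → contradiction (trans (sym Pv) eq) λ ()
... | no w≢u with w Fin.≟ v
...   | yes w≡v = λ _ → inj₁ w≡v
...   | no _    = λ eq → inj₂ (w≢u , eq)

≢type1 : ∀ {t} → t ≢ type1 → t ≡ type2
≢type1 {type1} t≢ = contradiction refl t≢
≢type1 {type2} _  = refl

≢⇒type1 : ∀ {s t} → s ≢ t → s ≡ type1 ⊎ t ≡ type1
≢⇒type1 {type1}         _   = inj₁ refl
≢⇒type1 {type2} {type1} _   = inj₂ refl
≢⇒type1 {type2} {type2} s≢t = contradiction refl s≢t

-- The graph and the two assignments.

module Construction (q : ℕ) where

  m K n : ℕ
  m = ℕ.suc q
  K = ℕ.suc m
  n = K ℕ.+ (K ℕ.* K ℕ.+ K ℕ.* m)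

  data V : Set where
    s : Fin K → V
    e : Fin K → Fin K → V
    b : Fin K → Fin m → V

  -- Each edge is listed in one orientation only; `Adj` symmetrises, so that symmetry is just
  -- `swap`.
  Edge : V → V → Set
  Edge (s i)      (e i′ _)       = i ≡ i′
  Edge (e _ j)    (b j′ zero)    = j ≡ j′
  Edge (b j zero) (b j′ (suc _)) = j ≡ j′
  Edge _          _              = ⊥

  edge? : ∀ x y → Dec (Edge x y)
  edge? (s _)         (s _)          = no λ ()
  edge? (s i)         (e i′ _)       = i Fin.≟ i′
  edge? (s _)         (b _ _)        = no λ ()
  edge? (e _ _)       (s _)          = no λ ()
  edge? (e _ _)       (e _ _)        = no λ ()
  edge? (e _ j)       (b j′ zero)    = j Fin.≟ j′
  edge? (e _ _)       (b _ (suc _))  = no λ ()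
  edge? (b _ zero)    (s _)          = no λ ()
  edge? (b _ zero)    (e _ _)        = no λ ()
  edge? (b _ zero)    (b _ zero)     = no λ ()
  edge? (b j zero)    (b j′ (suc _)) = j Fin.≟ j′
  edge? (b _ (suc _)) _              = no λ ()

  edge-irrefl : ∀ x → ¬ Edge x x
  edge-irrefl (b _ zero) ()

  Adj : V → V → Set
  Adj x y = Edge x y ⊎ Edge y x

  V↔⊎ : V ↔ (Fin K ⊎ (Fin K × Fin K ⊎ Fin K × Fin m))
  V↔⊎ = mk↔ₛ′
    (λ where
      (s i)   → inj₁ i
      (e i j) → inj₂ (inj₁ (i , j))
      (b j l) → inj₂ (inj₂ (j , l)))
    (λ where
      (inj₁ i)              → s i
      (inj₂ (inj₁ (i , j))) → e i j
      (inj₂ (inj₂ (j , l))) → b j l)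
    (λ where
      (inj₁ _)        → refl
      (inj₂ (inj₁ _)) → refl
      (inj₂ (inj₂ _)) → refl)
    (λ where
      (s _)   → refl
      (e _ _) → refl
      (b _ _) → refl)

  -- Only the inverse laws of this bijection are used; hiding its body keeps `vert` and `fin` from
  -- unfolding into arithmetic on `Fin`.
  abstract
    Fin↔V : Fin n ↔ V
    Fin↔V = ↔-trans (↔-trans Fin.+↔⊎ (↔-refl ⊎-↔ ↔-trans Fin.+↔⊎ (Fin.*↔× ⊎-↔ Fin.*↔×)))
                    (↔-sym V↔⊎)

  vert : Fin n → V
  vert = Inverse.to Fin↔V

  fin : V → Fin n
  fin = Inverse.from Fin↔V

  vert-fin : ∀ x → vert (fin x) ≡ x
  vert-fin = Inverse.strictlyInverseˡ Fin↔V

  fin-vert : ∀ v → fin (vert v) ≡ v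
  fin-vert = Inverse.strictlyInverseʳ Fin↔V

  vert-injective : Injective _≡_ _≡_ vert
  vert-injective = Injection.injective (↔⇒↣ Fin↔V)

  fin-injective : Injective _≡_ _≡_ fin
  fin-injective = Injection.injective (↔⇒↣ (↔-sym Fin↔V))

  I : Instance
  I = record
    { n     = n
    ; graph = record
      { _~_      = λ v w → Adj (vert v) (vert w)
      ; _~?_     = λ v w → edge? (vert v) (vert w) ⊎-dec edge? (vert w) (vert v)
      ; ~-sym    = swap
      ; ~-irrefl = λ where
          refl (inj₁ loop) → edge-irrefl _ loop
          refl (inj₂ loop) → edge-irrefl _ loop
      }
    ; k     = K
    -- `2 * K` unfolds to `K + (K + 0)`: the second `K` is at most `K * K`, and `0` at most `K * m`.
    ; k≤n/2 = ℕ.+-monoʳ-≤ K (ℕ.+-mono-≤ (ℕ.m≤m*n K K) ℕ.z≤n)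
    }

  isAssignment : ∀ P → # P of-type type1 ≡ K → IsAssignment I P
  isAssignment P #1≡K = #1≡K ,
    trans (sym (ℕ.m+n∸m≡n (# P of-type type1) _))
          (cong₂ ℕ._∸_ (type1+type2 P) #1≡K)

  typing : (c : V → Type) → Fin n → Type
  typing c = c ∘ vert

  typing-isAssignment : (c : V → Type) (g : Fin K → V) → Injective _≡_ _≡_ g →
    (∀ i → c (g i) ≡ type1) → (∀ x → c x ≡ type1 → ∃[ i ] g i ≡ x) →
    IsAssignment I (typing c)
  typing-isAssignment c g g-inj c∘g g⁻¹ = isAssignment (typing c) (count-≡ (λ v → c (vert v) ≟ type1) (fin ∘ g)
    (g-inj ∘ fin-injective)
    (λ i → trans (cong c (vert-fin (g i))) (c∘g i))
    (λ v cv → let i , gi≡v = g⁻¹ (vert v) cv in i , trans (cong fin gi≡v) (fin-vert v)))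

  typing-integrated : (c : V → Type) {x : V} (y : V) → Adj x y → c y ≢ c x →
                      Integrated I (typing c) (fin x)
  typing-integrated c {x} y x~y cy≢cx = fin y ,
    subst₂ Adj (sym (vert-fin x)) (sym (vert-fin y)) x~y ,
    subst₂ _≢_ (cong c (sym (vert-fin y))) (cong c (sym (vert-fin x))) cy≢cx

  local optimal : V → Type
  local (s _) = type1
  local (e _ _) = type2
  local (b _ _) = type2
  optimal (s _) = type2
  optimal (e _ _) = type2
  optimal (b _ zero) = type1
  optimal (b _ (suc _)) = type2

  local-type1 : ∀ x → local x ≡ type1 → ∃[ i ] s i ≡ x
  local-type1 (s i) _ = i , refl

  optimal-type1 : ∀ x → optimal x ≡ type1 → ∃[ j ] b j zero ≡ x
  optimal-type1 (b j zero) _ = j , refl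

  local-isAssignment : IsAssignment I (typing local)
  local-isAssignment = typing-isAssignment local s (λ { refl → refl }) (λ _ → refl)
    local-type1

  optimal-isAssignment : IsAssignment I (typing optimal)
  optimal-isAssignment = typing-isAssignment optimal (λ j → b j zero) (λ { refl → refl }) (λ _ → refl)
    optimal-type1

  -- Integrated vertices of the two assignments.

  IoA-local : IoA I (typing local) ℕ.≤ K ℕ.+ K ℕ.* K
  IoA-local = count-≤ (integrated? I (typing local))
    (λ v int → Inverse.from index↔ (star (vert v) (no-b v int)))
    λ {v} {w} p q eq → vert-injective (star-injective (vert v) (vert w) (no-b v p) (no-b w q)
      (Injection.injective (↔⇒↣ (↔-sym index↔)) eq))
    where
    index↔ : Fin (K ℕ.+ K ℕ.* K) ↔ (Fin K ⊎ Fin K × Fin K)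
    index↔ = ↔-trans Fin.+↔⊎ (↔-refl ⊎-↔ Fin.*↔×)

    NotB : V → Set
    NotB x = ∀ j l → x ≢ b j l

    -- The neighbours of a `b` are of the form `e` or `b`, and `local` gives all of these `type2`.
    no-b : ∀ v → Integrated I (typing local) v → NotB (vert v)
    no-b v (w , v~w , neq) = go (vert v) (vert w) v~w neq
      where
      go : ∀ x y → Adj x y → local y ≢ local x → NotB x
      go (b _ zero)    (s _)   (inj₁ ())
      go (b _ zero)    (s _)   (inj₂ ())
      go (b _ (suc _)) (s _)   (inj₁ ())
      go (b _ (suc _)) (s _)   (inj₂ ())
      go (b _ _)       (e _ _) _ neq _ _ = contradiction refl neq
      go (b _ _)       (b _ _) _ neq _ _ = contradiction refl neq

    star : ∀ x → NotB x → Fin K ⊎ Fin K × Fin K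
    star (s i)   _  = inj₁ i
    star (e i j) _  = inj₂ (i , j)
    star (b _ _) ¬b = contradiction refl (¬b _ _)

    star-injective : ∀ x y ¬bx ¬by → star x ¬bx ≡ star y ¬by → x ≡ y
    star-injective (s _)   (s _)   _   _   refl = refl
    star-injective (e _ _) (e _ _) _   _   refl = refl
    star-injective (b _ _) _       ¬bx _   _    = contradiction refl (¬bx _ _)
    star-injective (s _)   (b _ _) _   ¬by _    = contradiction refl (¬by _ _)
    star-injective (e _ _) (b _ _) _   ¬by _    = contradiction refl (¬by _ _)

  IoA-optimal : K ℕ.* K ℕ.+ K ℕ.* m ℕ.≤ IoA I (typing optimal)
  IoA-optimal = ≤-count (integrated? I (typing optimal))
    (fin ∘ covered ∘ Inverse.to index↔)
    (Injection.injective (↔⇒↣ index↔) ∘ covered-injective ∘ fin-injective)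
    (integrated ∘ Inverse.to index↔)
    where
    index↔ : Fin (K ℕ.* K ℕ.+ K ℕ.* m) ↔ (Fin K × Fin K ⊎ Fin K × Fin m)
    index↔ = ↔-trans Fin.+↔⊎ (Fin.*↔× ⊎-↔ Fin.*↔×)

    covered : Fin K × Fin K ⊎ Fin K × Fin m → V
    covered = Inverse.from V↔⊎ ∘ inj₂

    covered-injective : Injective _≡_ _≡_ covered
    covered-injective = inj₂-injective ∘ Injection.injective (↔⇒↣ (↔-sym V↔⊎))

    -- Every `e i j` and every `b j (suc l)` sees the centre `b j zero`, which in turn sees
    -- `e zero j`; any other row would serve as well.
    integrated : ∀ x → Integrated I (typing optimal) (fin (covered x))
    integrated (inj₁ (i , j))     = typing-integrated optimal {e i j} (b j zero) (inj₁ refl) λ ()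
    integrated (inj₂ (j , zero))  = typing-integrated optimal {b j zero} (e zero j) (inj₂ refl) λ ()
    integrated (inj₂ (j , suc l)) = typing-integrated optimal {b j (suc l)} (b j zero) (inj₂ refl) λ ()

  -- Saturation of the first assignment.

  -- The value at s i is junk.
  column : V → Fin K
  column (s i)   = i
  column (e _ j) = j
  column (b j _) = j

  -- The vertices, other than the s a, with no neighbour s a for a ≢ i.
  Released : Fin K → V → Set
  Released i (s _)   = ⊥
  Released i (e a _) = a ≡ i
  Released i (b _ _) = ⊤

  released-type2 : ∀ {i} x → Released i x → local x ≡ type2
  released-type2 (e _ _) _ = refl
  released-type2 (b _ _) _ = refl

  -- Edges between `e` and `b`, or between two `b`, stay inside one column, and the only other
  -- neighbour of `e i j` is `s i`. Hence once `s i` loses type 1, only a change within its own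
  -- column can integrate a released vertex.
  released-adj : ∀ {i} x y → Released i x → Adj x y →
                 y ≡ s i ⊎ local y ≡ type2 × column x ≡ column y
  released-adj (e _ _)       (s _)         refl (inj₂ refl) = inj₁ refl
  released-adj (e _ _)       (b _ zero)    _    (inj₁ refl) = inj₂ (refl , refl)
  released-adj (b _ zero)    (e _ _)       _    (inj₂ refl) = inj₂ (refl , refl)
  released-adj (b _ zero)    (b _ (suc _)) _    (inj₁ refl) = inj₂ (refl , refl)
  released-adj (e _ _)       (b _ zero)    _    (inj₂ ())
  released-adj (e _ _)       (b _ (suc _)) _    (inj₂ ())
  released-adj (b _ zero)    (b _ zero)    _    (inj₂ ())
  released-adj (b _ zero)    (b _ (suc _)) _    (inj₂ ())
  released-adj (b _ (suc _)) (b _ zero)    _    (inj₂ refl) = inj₂ (refl , refl)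

  -- `punchIn j` embeds the `m` indices `l` into the `K` columns while skipping `j`, so each `b j l`
  -- lands in row `i` outside its own column.
  replace : Fin K → V → V
  replace i (s a)   = s a
  replace i (e a c) = e a c
  replace i (b j l) = e i (punchIn j l)

  -- An `e` that collides with the image of `b j l` lies in row `i`, hence is released and lies in
  -- column `j`, which `punchIn j` avoids. Two `b` share a column, where `punchIn` is injective.
  replace-injective : ∀ {i c} x y → (Released i x → column x ≡ c) → (Released i y → column y ≡ c) →
                      replace i x ≡ replace i y → x ≡ y
  replace-injective (s _)   (s _)    _  _  refl = refl
  replace-injective (e _ _) (e _ _)  _  _  refl = refl
  replace-injective (e _ _) (b j l)  cx cy refl =
    contradiction (trans (cx refl) (sym (cy tt))) (Fin.punchInᵢ≢i j l)
  replace-injective (b j l) (e _ _)  cx cy refl =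
    contradiction (trans (cy refl) (sym (cx tt))) (Fin.punchInᵢ≢i j l)
  replace-injective (b j l) (b j′ l′) cx cy eq with refl ← trans (cx tt) (sym (cy tt)) =
    cong (b j) (Fin.punchIn-injective j l l′ (cong column eq))

  replace-integrated : ∀ i x → Integrated I (typing local) (fin (replace i x))
  replace-integrated i (s a)   = typing-integrated local {s a} (e a zero) (inj₁ refl) λ ()
  replace-integrated i (e a c) = typing-integrated local {e a c} (s a) (inj₂ refl) λ ()
  replace-integrated i (b j l) = typing-integrated local {e i (punchIn j l)} (s i) (inj₂ refl) λ ()

  local-saturated : Saturated I (typing local)
  local-saturated u v Pu Pv with i , si≡u ← local-type1 (vert u) Pu =
    ℕ.≤⇒≯ (count-mono (integrated? I P′) (integrated? I (typing local))
      (fin ∘ replace i ∘ vert)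
      (λ {w} _ → replace-integrated i (vert w))
      λ {v′} {w′} p q eq → vert-injective (replace-injective _ _ (in-column v′ p) (in-column w′ q) (fin-injective eq)))
    where
    P′ : Fin n → Type
    P′ = typing local ∘ transpose u v

    -- One end of the integrating edge has type 1 after the exchange. If it is `w`, then `w` is `v`,
    -- as released vertices had type 2. If it is `x`, then `x` is `v` or an old type-1 vertex other
    -- than `u`; `released-adj` leaves only `v`, in the column of `w`.
    in-column : ∀ w → Integrated I P′ w → Released i (vert w) → column (vert w) ≡ column (vert v)
    in-column w (x , w~x , x≢w) rel with ≢⇒type1 x≢w
    in-column w (x , w~x , x≢w) rel | inj₂ P′w with transpose-type1 (typing local) u v Pv w P′w
    ... | inj₁ refl     = refl
    ... | inj₂ (_ , Pw) = contradiction (trans (sym (released-type2 _ rel)) Pw) λ ()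
    in-column w (x , w~x , x≢w) rel | inj₁ P′x
      with transpose-type1 (typing local) u v Pv x P′x | released-adj _ _ rel w~x
    ... | inj₁ refl       | inj₁ v≡si      = contradiction (trans (sym Pv) (cong local v≡si)) λ ()
    ... | inj₁ refl       | inj₂ (_ , eq)  = eq
    ... | inj₂ (x≢u , _)  | inj₁ x≡si      = contradiction (vert-injective (trans x≡si si≡u)) x≢u
    ... | inj₂ (_ , Px)   | inj₂ (Px′ , _) = contradiction (trans (sym Px′) Px) λ ()

  -- Bounds on `OPT` and the comparison in the rationals.

  OPT-lower : K ℕ.* K ℕ.+ K ℕ.* m ℕ.≤ OPT I
  OPT-lower = ℕ.≤-trans IoA-optimal (OPT-upper I _ optimal-isAssignment)

  OPT-positive : 0 ℕ.< OPT I
  OPT-positive = ℕ.≤-trans (ℕ.s≤s ℕ.z≤n) OPT-lower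

-- The hypothesis is the case `p = 0`, where the factor is `(q + 3) / (2 (q + 1))`; a larger `p`
-- only increases it. Unnormalised rationals keep numerators and denominators explicit, free of gcd
-- reductions.
≤-½+ε : ∀ p q .(c : Coprime (ℕ.suc p) (ℕ.suc q)) a o → 2 ℕ.* ℕ.suc q ℕ.* a ℕ.≤ (ℕ.suc q ℕ.+ 2) ℕ.* o →
        (+ a) / 1 ≤ (½ + mkℚ +[1+ p ] q c) * ((+ o) / 1)
≤-½+ε p q c a o h = let ε = mkℚ +[1+ p ] q c in ℚ.toℚᵘ-cancel-≤ (begin
  toℚᵘ ((+ a) / 1)                        ≃⟨ ℚ.toℚᵘ-fromℚᵘ (mkℚᵘ (+ a) 0) ⟩
  mkℚᵘ (+ a) 0                            ≤⟨ *≤* cross-multiplied ⟩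
  sum ℚᵘ.* mkℚᵘ (+ o) 0
    ≃⟨ ℚᵘ.*-cong (ℚᵘ.≃-sym (ℚ.toℚᵘ-homo-+ ½ ε)) (ℚᵘ.≃-sym (ℚ.toℚᵘ-fromℚᵘ (mkℚᵘ (+ o) 0))) ⟩
  toℚᵘ (½ + ε) ℚᵘ.* toℚᵘ ((+ o) / 1)      ≃⟨ ℚ.toℚᵘ-homo-* (½ + ε) ((+ o) / 1) ⟨
  toℚᵘ ((½ + ε) * ((+ o) / 1))            ∎)
  where
  open ℚᵘ.≤-Reasoning
  sum : ℚᵘ.ℚᵘ
  sum = ℚᵘ.½ ℚᵘ.+ mkℚᵘ +[1+ p ] q
  denominators : ∀ a q → 2 ℕ.* ℕ.suc q ℕ.* a ≡ a ℕ.* (2 ℕ.* ℕ.suc q ℕ.* 1)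
  denominators = solve-∀
  numerator : ℕ
  -- The form to which the numerator of `sum` computes; `ℕ.suc q ℕ.+ 0` is `1 ℕ.* ℕ.suc q`.
  numerator = ℕ.suc q ℕ.+ 0 ℕ.+ ℕ.suc p ℕ.* 2
  1+q+2≤numerator : ℕ.suc q ℕ.+ 2 ℕ.≤ numerator
  1+q+2≤numerator = ℕ.+-mono-≤ (ℕ.m≤m+n (ℕ.suc q) 0) (ℕ.m≤m+n 2 (p ℕ.* 2))
  cross-multiplied : (+ a) ℤ.* ℚᵘ.↧ (sum ℚᵘ.* mkℚᵘ (+ o) 0) ℤ.≤ ℚᵘ.↥ (sum ℚᵘ.* mkℚᵘ (+ o) 0) ℤ.* ℤ.1ℤ
  cross-multiplied = subst₂ ℤ._≤_ (ℤ.pos-* a _) (trans (ℤ.pos-* numerator o) (sym (ℤ.*-identityʳ _)))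
    (ℤ.+≤+ (ℕ.≤-trans (ℕ.≤-reflexive (sym (denominators a q)))
      (ℕ.≤-trans h (ℕ.*-monoˡ-≤ o 1+q+2≤numerator))))

proposition4p10 : (ε : ℚ) → 0ℚ < ε →
    Σ[ I ∈ Instance ] Σ[ P ∈ (Fin (Instance.n I) → Type) ]
    (IsAssignment I P × Saturated I P × 0 ℕ.< OPT I ×
    ((+ IoA I P) / 1) ≤ (½ + ε) * ((+ OPT I) / 1))
proposition4p10 (mkℚ (+ 0)    q c) (*<* (ℤ.+<+ ()))
proposition4p10 (mkℚ -[1+ _ ] q c) (*<* ())
proposition4p10 (mkℚ +[1+ p ] q c) _ =
  I , typing local , local-isAssignment , local-saturated , OPT-positive ,
  ≤-½+ε p q c _ _ bound
  where
  -- `mkℚ` stores the denominator minus one, so `m` is the denominator of ε.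
  open Construction q
  open ℕ.≤-Reasoning
  bound : 2 ℕ.* m ℕ.* IoA I (typing local) ℕ.≤ (m ℕ.+ 2) ℕ.* OPT I
  bound = begin
    2 ℕ.* m ℕ.* IoA I (typing local)               ≤⟨ ℕ.*-monoʳ-≤ (2 ℕ.* m) IoA-local ⟩
    -- The added term is the exact slack: since `K + 1 = m + 2`, both sides of the equation after it
    -- equal `(m + 2) * K * (2 * m + 1)`.
    2 ℕ.* m ℕ.* (K ℕ.+ K ℕ.* K)                    ≤⟨ ℕ.m≤m+n _ ((m ℕ.+ 2) ℕ.* K) ⟩
    2 ℕ.* m ℕ.* (K ℕ.+ K ℕ.* K) ℕ.+ (m ℕ.+ 2) ℕ.* K ≡⟨ expand m ⟩
    (m ℕ.+ 2) ℕ.* (K ℕ.* K ℕ.+ K ℕ.* m)            ≤⟨ ℕ.*-monoʳ-≤ (m ℕ.+ 2) OPT-lower ⟩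
    (m ℕ.+ 2) ℕ.* OPT I                            ∎
    where
    expand : ∀ m → let K = ℕ.suc m in
      2 ℕ.* m ℕ.* (K ℕ.+ K ℕ.* K) ℕ.+ (m ℕ.+ 2) ℕ.* K ≡ (m ℕ.+ 2) ℕ.* (K ℕ.* K ℕ.+ K ℕ.* m)
    expand = solve-∀
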